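{- For any nonempty subsets $A,B\subseteq S(n)$, $$\log|M|\ \ge\ \tfrac12\log|A|+\tfrac12\log|B|,$$ where $M$ is the midpoint set of $A$ and $B$.
   Context: $S(n)$ is the symmetric group on $\{1,\dots,n\}$, equipped with the graph distance $\mathrm{d}$ of its Cayley graph generated by all transpositions ($\{a,b\}$ is an edge iff $a^{ -1}b$ is a transposition); equivalently $\mathrm{d}(a,b)=n-(\text{number of cycles of }a^{ -1}b)$. A permutation $m$ is a midpoint of $a$ and $b$ if $\mathrm{d}(a,m)+\mathrm{d}(m,b)=\mathrm{d}(a,b)$ and $\mathrm{d}(a,m)-\mathrm{d}(m,b)\in\{ -1,0,1\}$. The midpoint set of $A$ and $B$ is $M=\{m\in S(n): m\text{ is a midpoint of some }a\in A\text{ and }b\in B\}$. $|\cdot|$ denotes cardinality. -}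

module Defs where

open import Data.Nat using (ℕ; zero; suc; _∸_; _+_; _≤_; _≤?_)
open import Data.Fin using (Fin; toℕ; _≟_)
open import Data.Fin.Properties using (any?; all?)
open import Data.Vec using (Vec; lookup)
open import Data.List using (List; length; filter; allFin)
open import Data.List.Membership.Propositional using (_∈_)
open import Data.Product using (_×_; _,_; ∃-syntax)
open import Data.Sum using (_⊎_)
open import Function.Definitions using (Injective)
open import Relation.Binary.PropositionalEquality using (_≡_)
open import Relation.Nullary using (Dec; yes; no)

-- A permutation of {1..n} (0-based: Fin n) in one-line notation:
-- σ is the vector (σ(0), …, σ(n-1)).
Perm : ℕ → Set
Perm n = Vec (Fin n) n

-- Being a permutation: the map i ↦ σ(i) is injective (hence bijective on Fin n).
IsPerm : ∀ {n} → Perm n → Set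
IsPerm σ = Injective _≡_ _≡_ (lookup σ)

-- Inverse of a map Fin n → Fin n, computed by search (correct for bijections).
inv : ∀ {n} → (Fin n → Fin n) → Fin n → Fin n
inv f y with any? (λ x → f x ≟ y)
... | yes (x , _) = x
... | no _ = y

iter : ∀ {A : Set} → (A → A) → ℕ → A → A
iter f zero x = x
iter f (suc k) x = f (iter f k x)

-- i is the smallest element of its cycle under f (cycle length ≤ n)
isCycleMin? : ∀ {n} (f : Fin n → Fin n) (i : Fin n) →
  Dec (∀ (k : Fin n) → toℕ i ≤ toℕ (iter f (toℕ k) i))
isCycleMin? f i = all? (λ k → toℕ i ≤? toℕ (iter f (toℕ k) i))

-- number of cycles (including fixed points) of a permutation f of Fin n
cycles : ∀ {n} → (Fin n → Fin n) → ℕ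
cycles {n} f = length (filter (isCycleMin? f) (allFin n))

dist : ∀ {n} → Perm n → Perm n → ℕ
dist {n} a b = n ∸ cycles (λ x → inv (lookup a) (lookup b x))

IsMidpoint : ∀ {n} → Perm n → Perm n → Perm n → Set
IsMidpoint a m b =
  (dist a m + dist m b ≡ dist a b) ×
  (dist a m ≡ dist m b ⊎ (dist a m ≡ suc (dist m b) ⊎ suc (dist a m) ≡ dist m b))

InMidpointSet : ∀ {n} → List (Perm n) → List (Perm n) → Perm n → Set
InMidpointSet A B m =
  IsPerm m × ∃[ a ] ∃[ b ] (a ∈ A × b ∈ B × IsMidpoint a m b)

{-# OPTIONS --safe #-}
-- Write p = a⁻¹b uniquely as a product of transpositions (i j) with j < i and
-- with strictly increasing i; each factor merges the fixed point i into another
-- cycle, so the number of factors is the distance from a to b.  A new factor t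
-- can be absorbed into a factorisation p = uv on either side,
-- (uv)t = u(vt) = (u · vtv⁻¹)v, where vtv⁻¹ = (i (v j)).  Choosing the sides
-- alternately, in the two possible ways, gives p = uv = u′v′ such that au and
-- au′ are midpoints of a and b.  Finally q = u⁻¹u′ = (au)⁻¹(au′) determines p:
-- the largest point i moved by q is that of the last factor, cutting i out of its
-- q-cycle gives the quotient of the preceding stage, and j is then
-- read off from q.  Hence (a , b) ↦ (au , au′) is injective from A × B to M × M.
module Submission where

open import Defs
open import Data.Bool using (Bool; true; false; not)
open import Data.Fin using (Fin; zero; suc; toℕ; fromℕ<; _≟_)
open import Data.Fin.Permutation.Components using (transpose; transpose-inverse)
open import Data.Fin.Properties using (any?; toℕ<n; toℕ-fromℕ<; toℕ-injective; pigeonhole)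
open import Data.Nat using (ℕ; zero; suc; _+_; _*_; _∸_; _≤_; _<_; z≤n; s≤s; _<?_)
open import Data.Nat.Induction using (<-rec)
open import Data.Nat.Properties using (≤-refl; ≤-pred; ≤-reflexive; ≤-trans; <-trans; <-≤-trans; <⇒≤; <⇒≱; ≮⇒≥; n≮n; n<1+n; m≤n⇒m≤1+n; m≤n⇒m<n∨m≡n; <-cmp; m∸n+n≡m; +-monoʳ-<; +-suc; +-comm; m+n∸n≡m)
open import Data.List using (List; []; _∷_; _++_; map; length; filter; allFin; cartesianProduct)
open import Data.List.Properties using (length-++; length-map; filter-accept; filter-reject; filter-≐; filter-all; length-tabulate)
open import Data.List.Relation.Unary.All as All using (All; []; _∷_)
open import Data.List.Relation.Unary.AllPairs using (_∷_)
open import Data.List.Relation.Unary.Any using (here; there)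
open import Data.List.Relation.Unary.Unique.Propositional using (Unique)
open import Data.List.Relation.Unary.Unique.Propositional.Properties using (allFin⁺; cartesianProduct⁺)
open import Data.List.Membership.Propositional using (_∈_)
open import Data.List.Membership.Propositional.Properties using (∈-∃++; ∈-++⁻; ∈-++⁺ˡ; ∈-++⁺ʳ; ∈-allFin; ∈-cartesianProduct⁺; ∈-cartesianProduct⁻)
open import Data.Product using (_×_; _,_; ∃; ∃-syntax; proj₁; proj₂)
open import Data.Sum using (_⊎_; inj₁; inj₂)
open import Data.Vec using (lookup; tabulate)
open import Data.Vec.Properties using (lookup∘tabulate; tabulate-cong; tabulate∘lookup)
open import Function using (id; _∘_)
open import Function.Bundles using (_⇔_; Equivalence)
open import Function.Definitions using (Injective)
open import Relation.Binary.Definitions using (tri<; tri≈; tri>)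
open import Relation.Binary.PropositionalEquality using (_≡_; _≢_; _≗_; refl; sym; trans; cong; cong₂; subst; subst₂; ≢-sym; module ≡-Reasoning)
open import Relation.Nullary using (¬_; Dec; yes; no; contradiction)
open import Relation.Unary using (Decidable)

private
  variable
    n k : ℕ

-- Counting in lists

-- Induction on `xs`: the partner `y` of the head is deleted from `ys`, and the remaining elements
-- of `xs` keep their partners because `R-inj` forbids sharing `y`.
length-≤-of-injective-relation : {X Y : Set} (R : X → Y → Set) →
  (∀ {x x′ y} → R x y → R x′ y → x ≡ x′) →
  ∀ {xs} ys → Unique xs → (∀ {x} → x ∈ xs → ∃ λ y → y ∈ ys × R x y) →
  length xs ≤ length ys
length-≤-of-injective-relation R R-inj {[]} ys _ _ = z≤n
length-≤-of-injective-relation R R-inj {x ∷ xs} ys (x∉xs ∷ uniq) image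
  with y , y∈ys , Rxy ← image (here refl)
  with ys₁ , ys₂ , refl ← ∈-∃++ y∈ys =
  ≤-trans (s≤s (length-≤-of-injective-relation R R-inj (ys₁ ++ ys₂) uniq image′))
          (≤-reflexive length-middle)
  where
  image′ : ∀ {x′} → x′ ∈ xs → ∃ λ y′ → y′ ∈ ys₁ ++ ys₂ × R x′ y′
  image′ x′∈xs with y′ , y′∈ys , Rx′y′ ← image (there x′∈xs) with ∈-++⁻ ys₁ y′∈ys
  ... | inj₁ y′∈ys₁ = y′ , ∈-++⁺ˡ y′∈ys₁ , Rx′y′
  ... | inj₂ (there y′∈ys₂) = y′ , ∈-++⁺ʳ ys₁ y′∈ys₂ , Rx′y′
  -- A shared partner would identify the head with a later element, against uniqueness of the list.
  ... | inj₂ (here refl) = contradiction (R-inj Rxy Rx′y′) (All.lookup x∉xs x′∈xs)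

  length-middle : suc (length (ys₁ ++ ys₂)) ≡ length (ys₁ ++ y ∷ ys₂)
  length-middle = begin
    suc (length (ys₁ ++ ys₂))       ≡⟨ cong suc (length-++ ys₁) ⟩
    suc (length ys₁ + length ys₂)   ≡⟨ sym (+-suc (length ys₁) (length ys₂)) ⟩
    length ys₁ + suc (length ys₂)   ≡⟨ sym (length-++ ys₁) ⟩
    length (ys₁ ++ y ∷ ys₂)         ∎
    where open ≡-Reasoning

length-cartesianProduct : {X Y : Set} (xs : List X) (ys : List Y) →
  length (cartesianProduct xs ys) ≡ length xs * length ys
length-cartesianProduct [] ys = refl
length-cartesianProduct (x ∷ xs) ys =
  trans (length-++ (map (x ,_) ys))
        (cong₂ _+_ (length-map (x ,_) ys) (length-cartesianProduct xs ys))

module _ {X : Set} {P Q : X → Set} (P? : Decidable P) (Q? : Decidable Q) where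

  filter-cong-All : ∀ {xs} → All (λ x → (P x → Q x) × (Q x → P x)) xs →
                    filter P? xs ≡ filter Q? xs
  filter-cong-All [] = refl
  filter-cong-All {x ∷ xs} ((P⇒Q , Q⇒P) ∷ rest) with P? x
  ... | yes Px = trans (cong (x ∷_) (filter-cong-All rest)) (sym (filter-accept Q? (P⇒Q Px)))
  ... | no ¬Px = trans (filter-cong-All rest) (sym (filter-reject Q? (¬Px ∘ Q⇒P)))

  -- Serves to compare the cycle minima of two permutations when only the point `i` stops being one.
  length-filter-lose-one : ∀ {i} → P i → ¬ Q i →
    (∀ {x} → Q x → P x) → (∀ {x} → x ≢ i → P x → Q x) →
    ∀ {xs} → Unique xs → i ∈ xs →
    length (filter P? xs) ≡ suc (length (filter Q? xs))
  length-filter-lose-one {i} Pi ¬Qi Q⇒P P⇒Q {_ ∷ xs} (i∉xs ∷ _) (here refl) = begin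
    length (filter P? (i ∷ xs))        ≡⟨ cong length (filter-accept P? Pi) ⟩
    suc (length (filter P? xs))        ≡⟨ cong (suc ∘ length) (filter-cong-All (All.map (λ i≢x → P⇒Q (≢-sym i≢x) , Q⇒P) i∉xs)) ⟩
    suc (length (filter Q? xs))        ≡⟨ cong (suc ∘ length) (sym (filter-reject Q? ¬Qi)) ⟩
    suc (length (filter Q? (i ∷ xs)))  ∎
    where open ≡-Reasoning
  length-filter-lose-one Pi ¬Qi Q⇒P P⇒Q {x ∷ xs} (x∉xs ∷ uniq) (there i∈xs)
    with ih ← length-filter-lose-one Pi ¬Qi Q⇒P P⇒Q uniq i∈xs with P? x
  ... | yes Px = trans (cong suc ih)
                   (cong (suc ∘ length) (sym (filter-accept Q? (P⇒Q (All.lookup x∉xs i∈xs) Px))))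
  ... | no ¬Px = trans ih (cong (suc ∘ length) (sym (filter-reject Q? (¬Px ∘ Q⇒P))))

-- Injective self-maps of Fin n

-- Pigeonhole for the `n + 1` values consisting of `y` and all `f x`: two values of `f` at distinct
-- points differ, so a collision must involve `y`.
injective⇒surjective : {f : Fin n → Fin n} → Injective _≡_ _≡_ f → ∀ y → ∃ λ x → f x ≡ y
injective⇒surjective {n} {f} f-inj y
  with pigeonhole (n<1+n n) (λ { zero → y ; (suc x) → f x })
... | zero  , suc x , _       , y≡fx   = x , sym y≡fx
... | suc x , suc z , s≤s x<z , fx≡fz with refl ← f-inj fx≡fz = contradiction x<z (n≮n _)

inv-right : {f : Fin n → Fin n} → Injective _≡_ _≡_ f → ∀ y → f (inv f y) ≡ y
inv-right {f = f} f-inj y with any? (λ x → f x ≟ y)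
... | yes (_ , fx≡y) = fx≡y
... | no ¬∃ = contradiction (injective⇒surjective f-inj y) ¬∃

inv-left : {f : Fin n → Fin n} → Injective _≡_ _≡_ f → ∀ x → inv f (f x) ≡ x
inv-left f-inj x = f-inj (inv-right f-inj _)

-- Transpositions and permutations supported on an initial segment

transpose-first : (i j : Fin n) → transpose i j i ≡ j
transpose-first i j with i ≟ i
... | yes _  = refl
... | no i≢i = contradiction refl i≢i

transpose-second : (i j : Fin n) → transpose i j j ≡ i
transpose-second i j with j ≟ i
... | yes j≡i = j≡i
... | no _ with j ≟ j
...   | yes _  = refl
...   | no j≢j = contradiction refl j≢j

transpose-other : {i j x : Fin n} → x ≢ i → x ≢ j → transpose i j x ≡ x
transpose-other {i = i} {j} {x} x≢i x≢j with x ≟ i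
... | yes x≡i = contradiction x≡i x≢i
... | no _ with x ≟ j
...   | yes x≡j = contradiction x≡j x≢j
...   | no _    = refl

transpose-injective : (i j : Fin n) → Injective _≡_ _≡_ (transpose i j)
transpose-injective i j eq =
  trans (sym (transpose-inverse j i)) (trans (cong (transpose j i) eq) (transpose-inverse j i))

transpose≡first⇒second : (i j : Fin n) {x : Fin n} → transpose i j x ≡ i → x ≡ j
transpose≡first⇒second i j eq = transpose-injective i j (trans eq (sym (transpose-second i j)))

-- The copy of the symmetric group on the first `k` points. Preservation of these points follows
-- from the two fields.
record PermutesBelow (k : ℕ) (f : Fin n → Fin n) : Set where
  field
    injective : Injective _≡_ _≡_ f
    fixes     : ∀ {x} → k ≤ toℕ x → f x ≡ x

  preserves-< : ∀ {x} → toℕ x < k → toℕ (f x) < k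
  preserves-< {x} x<k with toℕ (f x) <? k
  ... | yes fx<k = fx<k
  -- If `f x` lay at or above `k`, it would be fixed, so `f (f x) = f x` and injectivity would give
  -- `f x = x`.
  ... | no  fx≮k = contradiction (subst (_≤_ k) (cong toℕ (injective (fixes (≮⇒≥ fx≮k)))) (≮⇒≥ fx≮k)) (<⇒≱ x<k)

open PermutesBelow

id-permutesBelow : PermutesBelow {n} k id
id-permutesBelow = record { injective = id ; fixes = λ _ → refl }

permutesBelow-mono : ∀ {k′} {f : Fin n → Fin n} → k ≤ k′ → PermutesBelow k f → PermutesBelow k′ f
permutesBelow-mono k≤k′ pf = record { injective = injective pf ; fixes = fixes pf ∘ ≤-trans k≤k′ }

<⇒≢ᶠ : {x y : Fin n} → toℕ x < toℕ y → x ≢ y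
<⇒≢ᶠ x<y refl = n≮n _ x<y

∘-transpose-permutesBelow : {f : Fin n → Fin n} {i j : Fin n} →
  toℕ i < k → toℕ j < toℕ i → PermutesBelow (toℕ i) f → PermutesBelow k (f ∘ transpose i j)
∘-transpose-permutesBelow {f = f} {i} {j} i<k j<i pf = record
  { injective = transpose-injective i j ∘ injective pf
  ; fixes = λ k≤x →
      let i<x = <-≤-trans i<k k≤x in
      trans (cong f (transpose-other (≢-sym (<⇒≢ᶠ i<x)) (≢-sym (<⇒≢ᶠ (<-trans j<i i<x)))))
            (fixes pf (<⇒≤ i<x))
  }

-- Cycles

iter-+ : {X : Set} (f : X → X) (a b : ℕ) (x : X) → iter f (a + b) x ≡ iter f a (iter f b x)
iter-+ f zero    b x = refl
iter-+ f (suc a) b x = cong f (iter-+ f a b x)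

iter-cong : {X : Set} {f g : X → X} → f ≗ g → ∀ m → iter f m ≗ iter g m
iter-cong f≗g zero    x = refl
iter-cong {f = f} f≗g (suc m) x = trans (cong f (iter-cong f≗g m x)) (f≗g _)

-- Two of the first `n + 1` iterates coincide, at exponents `i < j`; if `m` is at least `n`,
-- replacing `j` by `i` inside `m` yields a smaller exponent with the same value.
iter-within : (f : Fin n → Fin n) (x : Fin n) (m : ℕ) →
  ∃ λ (l : Fin n) → iter f m x ≡ iter f (toℕ l) x
iter-within {n} f x = <-rec _ reduce
  where
  reduce : ∀ m → (∀ {m′} → m′ < m → ∃ λ (l : Fin n) → iter f m′ x ≡ iter f (toℕ l) x) →
           ∃ λ (l : Fin n) → iter f m x ≡ iter f (toℕ l) x
  reduce m rec with m <? n
  ... | yes m<n = fromℕ< m<n , cong (λ l → iter f l x) (sym (toℕ-fromℕ< m<n))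
  ... | no m≮n
    with i , j , i<j , eq ← pigeonhole (n<1+n n) (λ l → iter f (toℕ l) x)
    with j≤m ← ≤-trans (≤-pred (toℕ<n j)) (≮⇒≥ m≮n)
    with l , eq′ ← rec (subst (m ∸ toℕ j + toℕ i <_) (m∸n+n≡m j≤m) (+-monoʳ-< (m ∸ toℕ j) i<j)) =
    l , (begin
      iter f m x                              ≡⟨ cong (λ a → iter f a x) (sym (m∸n+n≡m j≤m)) ⟩
      iter f (m ∸ toℕ j + toℕ j) x            ≡⟨ iter-+ f (m ∸ toℕ j) (toℕ j) x ⟩
      iter f (m ∸ toℕ j) (iter f (toℕ j) x)   ≡⟨ cong (iter f (m ∸ toℕ j)) (sym eq) ⟩
      iter f (m ∸ toℕ j) (iter f (toℕ i) x)   ≡⟨ sym (iter-+ f (m ∸ toℕ j) (toℕ i) x) ⟩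
      iter f (m ∸ toℕ j + toℕ i) x            ≡⟨ eq′ ⟩
      iter f (toℕ l) x                        ∎)
    where open ≡-Reasoning

-- Minimality over all exponents, so that orbits of different maps can be compared without keeping
-- exponents below `n`.
IsOrbitMin : (Fin n → Fin n) → Fin n → Set
IsOrbitMin f x = ∀ m → toℕ x ≤ toℕ (iter f m x)

cycleMin⇒orbitMin : {f : Fin n → Fin n} {x : Fin n} →
  (∀ (l : Fin n) → toℕ x ≤ toℕ (iter f (toℕ l) x)) → IsOrbitMin f x
cycleMin⇒orbitMin {f = f} {x} min m with l , eq ← iter-within f x m =
  subst (λ y → toℕ x ≤ toℕ y) (sym eq) (min l)

cycles-cong : {f g : Fin n → Fin n} → f ≗ g → cycles f ≡ cycles g
cycles-cong {n} {f} {g} f≗g = cong length (filter-≐ (isCycleMin? f) (isCycleMin? g)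
  ( (λ {x} min l → subst (λ y → toℕ x ≤ toℕ y) (iter-cong f≗g (toℕ l) x) (min l))
  , (λ {x} min l → subst (λ y → toℕ x ≤ toℕ y) (sym (iter-cong f≗g (toℕ l) x)) (min l)))
  (allFin n))

iter-fixed : {X : Set} {f : X → X} {x : X} → f x ≡ x → ∀ m → iter f m x ≡ x
iter-fixed fx≡x zero    = refl
iter-fixed {f = f} fx≡x (suc m) = trans (cong f (iter-fixed fx≡x m)) fx≡x

cycles-id : cycles {n} id ≡ n
cycles-id {n} = trans
  (cong length (filter-all (isCycleMin? id)
    (All.tabulate {xs = allFin n} λ {x} _ l → ≤-reflexive (cong toℕ (sym (iter-fixed {f = id} {x} refl (toℕ l)))))))
  (length-tabulate id)

module _ {f : Fin n → Fin n} {i j : Fin n} (pf : PermutesBelow (toℕ i) f) (j<i : toℕ j < toℕ i) where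

  private
    g : Fin n → Fin n
    g = f ∘ transpose i j

    fi≡i : f i ≡ i
    fi≡i = fixes pf ≤-refl

    f-avoids : ∀ {y} → y ≢ i → f y ≢ i
    f-avoids y≢i fy≡i = y≢i (injective pf (trans fy≡i (sym fi≡i)))

    gi≡fj : g i ≡ f j
    gi≡fj = cong f (transpose-first i j)

    gj≡i : g j ≡ i
    gj≡i = trans (cong f (transpose-second i j)) fi≡i

    -- The map `g` is `f` with a detour `j ↦ i ↦ f j`. When the orbit is at `i`, the invariant
    -- remembers that `j` lies on the `f`-orbit, from which the next step continues.
    g-orbit : ∀ {x} → x ≢ i → ∀ m →
      (iter g m x ≢ i × ∃ λ l → iter g m x ≡ iter f l x) ⊎
      (iter g m x ≡ i × ∃ λ l → j ≡ iter f l x)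
    g-orbit x≢i zero = inj₁ (x≢i , 0 , refl)
    g-orbit {x} x≢i (suc m) with g-orbit x≢i m
    ... | inj₂ (y≡i , l , j≡) =
      inj₁ ( (λ gy≡i → f-avoids (<⇒≢ᶠ j<i) (trans (sym gi≡fj) (trans (cong g (sym y≡i)) gy≡i)))
           , suc l , trans (cong g y≡i) (trans gi≡fj (cong f j≡)))
    ... | inj₁ (y≢i , l , y≡) with iter g m x ≟ j
    ...   | yes y≡j = inj₂ (trans (cong g y≡j) gj≡i , l , trans (sym y≡j) y≡)
    ...   | no y≢j with gy≡fy ← cong f (transpose-other y≢i y≢j) =
      inj₁ ((λ gy≡i → f-avoids y≢i (trans (sym gy≡fy) gy≡i)) , suc l , trans gy≡fy (cong f y≡))

    -- A step of `f` out of `j` takes two steps of `g`, through `i`, whence `suc (suc l)`.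
    f-orbit : ∀ {x} → x ≢ i → ∀ m →
      iter f m x ≢ i × ∃ λ l → iter f m x ≡ iter g l x
    f-orbit x≢i zero = x≢i , 0 , refl
    f-orbit {x} x≢i (suc m) with y≢i , l , y≡ ← f-orbit x≢i m with iter f m x ≟ j
    ... | yes y≡j = f-avoids y≢i , suc (suc l) ,
          trans (cong f y≡j) (trans (sym gi≡fj) (cong g (trans (sym gj≡i) (cong g (trans (sym y≡j) y≡)))))
    ... | no y≢j = f-avoids y≢i , suc l ,
          trans (sym (cong f (transpose-other y≢i y≢j))) (cong g y≡)

    f-min⇒g-min : ∀ {x} → x ≢ i → IsOrbitMin f x → IsOrbitMin g x
    f-min⇒g-min {x} x≢i min m with g-orbit x≢i m
    ... | inj₁ (_ , l , y≡) = subst (λ y → toℕ x ≤ toℕ y) (sym y≡) (min l)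
    -- The inserted point cannot undercut the minimum: `x ≤ j < i`, as `j` is on the `f`-orbit of
    -- `x`.
    ... | inj₂ (y≡i , l , j≡) = subst (λ y → toℕ x ≤ toℕ y) (sym y≡i)
          (≤-trans (subst (λ y → toℕ x ≤ toℕ y) (sym j≡) (min l)) (<⇒≤ j<i))

    g-min⇒f-min : ∀ {x} → IsOrbitMin g x → IsOrbitMin f x
    g-min⇒f-min {x} min m with x ≟ i
    ... | yes refl = ≤-reflexive (cong toℕ (sym (iter-fixed fi≡i m)))
    ... | no x≢i with _ , l , y≡ ← f-orbit x≢i m = subst (λ y → toℕ x ≤ toℕ y) (sym y≡) (min l)

    ¬g-min : ¬ IsOrbitMin g i
    ¬g-min min = <⇒≱ (preserves-< pf j<i) (subst (λ y → toℕ i ≤ toℕ y) gi≡fj (min 1))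

  -- Exactly one cycle minimum is lost: `i` is a fixed point of `f`, while `g i = f j` is smaller
  -- than `i`.
  cycles-∘-transpose : cycles f ≡ suc (cycles (f ∘ transpose i j))
  cycles-∘-transpose = length-filter-lose-one (isCycleMin? f) (isCycleMin? g)
    (λ l → ≤-reflexive (cong toℕ (sym (iter-fixed fi≡i (toℕ l)))))
    (¬g-min ∘ cycleMin⇒orbitMin)
    (λ min l → g-min⇒f-min (cycleMin⇒orbitMin min) (toℕ l))
    (λ x≢i min l → f-min⇒g-min x≢i (cycleMin⇒orbitMin min) (toℕ l))
    (allFin⁺ n) (∈-allFin i)

-- Words of transpositions

Word : ℕ → Set
Word n = List (Fin n × Fin n)

-- The head is the rightmost factor of the product, since `eval` applies it first, so its `i` is the
-- largest. The bound ensures that the tail permutes the points below that `i`.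
data Descending {n : ℕ} : ℕ → Word n → Set where
  []   : Descending k []
  step : ∀ {i j w} → toℕ i < k → toℕ j < toℕ i → Descending (toℕ i) w →
         Descending k ((i , j) ∷ w)

eval : Word n → Fin n → Fin n
eval []            x = x
eval ((i , j) ∷ w) x = eval w (transpose i j x)

-- The Boolean tells whether the head of the word is absorbed on the right;
-- the side then alternates along the word.
mutual
  left : Bool → Word n → Fin n → Fin n
  left _     []            x = x
  left true  ((i , j) ∷ w) x = left false w x
  left false ((i , j) ∷ w) x = left true w (transpose i (right true w j) x)

  right : Bool → Word n → Fin n → Fin n
  right _     []            x = x
  right true  ((i , j) ∷ w) x = right false w (transpose i j x)
  right false ((i , j) ∷ w) x = right true w x

-- The number of factors absorbed by `left s w`. As the sides alternate, `leftLength (not s) w`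
-- counts those absorbed by `right s w`.
leftLength : Bool → Word n → ℕ
leftLength _     []      = 0
leftLength true  (_ ∷ w) = leftLength false w
leftLength false (_ ∷ w) = suc (leftLength true w)

mutual
  -- A factor absorbed on the left becomes `(i (v j))` with `v = right true w`. As `v` permutes the
  -- points below `i`, still `v j < i`, which is why both sides are handled by mutual recursion on
  -- the same word or by its tail.
  left-permutesBelow : ∀ s {w : Word n} → Descending k w → PermutesBelow k (left s w)
  left-permutesBelow true  [] = id-permutesBelow
  left-permutesBelow false [] = id-permutesBelow
  left-permutesBelow true  (step i<k j<i d) =
    permutesBelow-mono (<⇒≤ i<k) (left-permutesBelow false d)
  left-permutesBelow false (step i<k j<i d) =
    ∘-transpose-permutesBelow i<k (preserves-< (right-permutesBelow true d) j<i) (left-permutesBelow true d)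

  right-permutesBelow : ∀ s {w : Word n} → Descending k w → PermutesBelow k (right s w)
  right-permutesBelow true  [] = id-permutesBelow
  right-permutesBelow false [] = id-permutesBelow
  right-permutesBelow true  (step i<k j<i d) =
    ∘-transpose-permutesBelow i<k j<i (right-permutesBelow false d)
  right-permutesBelow false (step i<k j<i d) =
    permutesBelow-mono (<⇒≤ i<k) (right-permutesBelow true d)

eval-permutesBelow : {w : Word n} → Descending k w → PermutesBelow k (eval w)
eval-permutesBelow [] = id-permutesBelow
eval-permutesBelow (step i<k j<i d) = ∘-transpose-permutesBelow i<k j<i (eval-permutesBelow d)

-- Conjugation of a transposition, in a form free of inverses.
transpose-natural : {f : Fin n → Fin n} → Injective _≡_ _≡_ f → ∀ i j x →
  transpose (f i) (f j) (f x) ≡ f (transpose i j x)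
transpose-natural {f = f} f-inj i j x with x ≟ i
... | yes refl = transpose-first (f i) (f j)
... | no x≢i with x ≟ j
...   | yes refl = transpose-second (f i) (f j)
...   | no x≢j = transpose-other (x≢i ∘ f-inj) (x≢j ∘ f-inj)

left-right : ∀ s {w : Word n} → Descending k w → ∀ x → left s w (right s w x) ≡ eval w x
left-right true  [] x = refl
left-right false [] x = refl
left-right true  (step i<k j<i d) x = left-right false d _
left-right false (step {i = i} {j} {w} i<k j<i d) x = begin
  -- Since `v` fixes `i`, the absorbed factor is the conjugate of `(i j)` by `v` and can be moved
  -- across `v`.
  left true w (transpose i (v j) (v x))      ≡⟨ cong (λ y → left true w (transpose y (v j) (v x))) (sym (fixes pv ≤-refl)) ⟩
  left true w (transpose (v i) (v j) (v x))  ≡⟨ cong (left true w) (transpose-natural (injective pv) i j x) ⟩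
  left true w (v (transpose i j x))          ≡⟨ left-right true d _ ⟩
  eval w (transpose i j x)                   ∎
  where
  open ≡-Reasoning
  v  = right true w
  pv = right-permutesBelow true d

-- Every factor merges the fixed point `i` of the tail into another cycle. The additive form avoids
-- truncated subtraction.
cycles-eval : {w : Word n} → Descending k w → cycles (eval w) + length w ≡ n
cycles-eval [] = trans (+-comm _ 0) cycles-id
cycles-eval (step {w = w} i<k j<i d) =
  trans (+-suc _ _) (trans
    (cong (_+ length w) (sym (cycles-∘-transpose (eval-permutesBelow d) j<i)))
    (cycles-eval d))

cycles-left : ∀ s {w : Word n} → Descending k w → cycles (left s w) + leftLength s w ≡ n
cycles-left true  [] = trans (+-comm _ 0) cycles-id
cycles-left false [] = trans (+-comm _ 0) cycles-id
cycles-left true  (step i<k j<i d) = cycles-left false d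
cycles-left false (step {w = w} i<k j<i d) =
  trans (+-suc _ _) (trans
    (cong (_+ leftLength true w) (sym (cycles-∘-transpose (left-permutesBelow true d)
      (preserves-< (right-permutesBelow true d) j<i))))
    (cycles-left true d))

cycles-right : ∀ s {w : Word n} → Descending k w → cycles (right s w) + leftLength (not s) w ≡ n
cycles-right true  [] = trans (+-comm _ 0) cycles-id
cycles-right false [] = trans (+-comm _ 0) cycles-id
cycles-right true  (step {w = w} i<k j<i d) =
  trans (+-suc _ _) (trans
    (cong (_+ leftLength true w) (sym (cycles-∘-transpose (right-permutesBelow false d) j<i)))
    (cycles-right false d))
cycles-right false (step i<k j<i d) = cycles-right true d

leftLength-sum : ∀ s (w : Word n) → leftLength s w + leftLength (not s) w ≡ length w
leftLength-sum true  []      = refl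
leftLength-sum false []      = refl
leftLength-sum true  (_ ∷ w) = trans (+-suc _ _) (cong suc (leftLength-sum false w))
leftLength-sum false (_ ∷ w) = cong suc (leftLength-sum true w)

-- A new head exchanges the two lengths and then adds one to the second, so a difference of 0
-- becomes 1 and a difference of 1 becomes 0.
leftLength-balanced : ∀ (w : Word n) →
  leftLength true w ≡ leftLength false w ⊎ suc (leftLength true w) ≡ leftLength false w
leftLength-balanced []      = inj₁ refl
leftLength-balanced (_ ∷ w) with leftLength-balanced w
... | inj₁ eq = inj₂ (cong suc (sym eq))
... | inj₂ eq = inj₁ (sym eq)

-- Existence of the factorisation

descending-weaken : {w : Word n} → Descending k w → Descending (suc k) w
descending-weaken [] = []
descending-weaken (step i<k j<i d) = step (m≤n⇒m≤1+n i<k) j<i d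

-- Induction on `k`, with `i` the top point that `p` may move. If `p` moves `i` and `p j = i`, then
-- `p ∘ transpose j i` fixes `i`, and `(i , j)` becomes the head of the word.
factorise : ∀ k → k ≤ n → {p : Fin n → Fin n} → PermutesBelow k p →
  ∃ λ w → Descending k w × eval w ≗ p
factorise zero _ pp = [] , [] , λ x → sym (fixes pp z≤n)
factorise {n} (suc k) k<n {p} pp = split (p i ≟ i)
  where
  i : Fin n
  i = fromℕ< k<n

  i≡k : toℕ i ≡ k
  i≡k = toℕ-fromℕ< k<n

  k≤⇒≡i⊎k< : ∀ {x : Fin n} → k ≤ toℕ x → i ≡ x ⊎ suc k ≤ toℕ x
  k≤⇒≡i⊎k< k≤x with m≤n⇒m<n∨m≡n k≤x
  ... | inj₁ k<x = inj₂ k<x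
  ... | inj₂ k≡x = inj₁ (toℕ-injective (trans i≡k k≡x))

  fixing-i : p i ≡ i → PermutesBelow k p
  fixing-i pi≡i = record { injective = injective pp ; fixes = fixed ∘ k≤⇒≡i⊎k< }
    where
    fixed : ∀ {x} → i ≡ x ⊎ suc k ≤ toℕ x → p x ≡ x
    fixed (inj₁ refl) = pi≡i
    fixed (inj₂ k<x)  = fixes pp k<x

  module _ (pi≢i : p i ≢ i) {j : Fin n} (pj≡i : p j ≡ i) where

    j<i : toℕ j < toℕ i
    j<i with toℕ j <? toℕ i
    ... | yes lt = lt
    ... | no j≮i with k≤⇒≡i⊎k< (subst (_≤ toℕ j) i≡k (≮⇒≥ j≮i))
    ...   | inj₁ refl = contradiction pj≡i pi≢i
    ...   | inj₂ k<j  = contradiction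
            (≤-reflexive (trans (cong toℕ (trans (sym (fixes pp k<j)) pj≡i)) i≡k)) (<⇒≱ k<j)

    moving-i : PermutesBelow k (p ∘ transpose j i)
    moving-i = record
      { injective = transpose-injective j i ∘ injective pp
      ; fixes     = fixed ∘ k≤⇒≡i⊎k<
      }
      where
      fixed : ∀ {x} → i ≡ x ⊎ suc k ≤ toℕ x → p (transpose j i x) ≡ x
      fixed (inj₁ refl) = trans (cong p (transpose-second j i)) pj≡i
      fixed {x} (inj₂ k<x) = trans
        (cong p (transpose-other (≢-sym (<⇒≢ᶠ (<-trans j<i i<x))) (≢-sym (<⇒≢ᶠ i<x))))
        (fixes pp k<x)
        where
        i<x : toℕ i < toℕ x
        i<x = subst (_< toℕ x) (sym i≡k) k<x

  split : Dec (p i ≡ i) → ∃ λ w → Descending (suc k) w × eval w ≗ p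
  split (yes pi≡i) with w , d , ev ← factorise k (<⇒≤ k<n) (fixing-i pi≡i) =
    w , descending-weaken d , ev
  split (no pi≢i)
    with j , pj≡i ← injective⇒surjective (injective pp) i
    with w , d , ev ← factorise k (<⇒≤ k<n) (moving-i pi≢i pj≡i) =
    (i , j) ∷ w ,
    step (≤-reflexive (cong suc i≡k)) (j<i pi≢i pj≡i)
         (subst (λ l → Descending l w) (sym i≡k) d) ,
    λ x → trans (ev (transpose i j x)) (cong p (transpose-inverse j i))

-- Recovering the word

-- q = (left s w)⁻¹ ∘ left (not s) w
IsQuotient : Bool → Word n → (Fin n → Fin n) → Set
IsQuotient s w q = ∀ x → left s w (q x) ≡ left (not s) w x

cutOut : Fin n → (Fin n → Fin n) → Fin n → Fin n
cutOut i q x with x ≟ i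
... | yes _ = i
... | no _ with q x ≟ i
...   | yes _ = q i
...   | no _  = q x

quotient-fixes : ∀ s {w : Word n} {q} → Descending k w → IsQuotient s w q →
  ∀ {x} → k ≤ toℕ x → q x ≡ x
quotient-fixes s d isQ {x} k≤x = injective (left-permutesBelow s d)
  (trans (isQ x) (trans (fixes (left-permutesBelow (not s) d) k≤x) (sym (fixes (left-permutesBelow s d) k≤x))))

-- Both sides of the tail fix `i`, while the head sends it to `right true w j`, which lies below `i`
-- and stays there under `left true w`. With `quotient-fixes`, this makes `i` the largest point
-- moved by `q`.
quotient-moves : ∀ s {w : Word n} {q i j} → Descending k ((i , j) ∷ w) →
  IsQuotient s ((i , j) ∷ w) q → q i ≢ i
quotient-moves true {w} {q} {i} {j} (step i<k j<i d) isQ qi≡i =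
  <⇒≢ᶠ (preserves-< (left-permutesBelow true d) (preserves-< (right-permutesBelow true d) j<i)) (begin
    left true w (right true w j)                    ≡⟨ cong (left true w) (sym (transpose-first i _)) ⟩
    left true w (transpose i (right true w j) i)    ≡⟨ sym (isQ i) ⟩
    left false w (q i)                              ≡⟨ cong (left false w) qi≡i ⟩
    left false w i                                  ≡⟨ fixes (left-permutesBelow false d) ≤-refl ⟩
    i                                               ∎)
  where open ≡-Reasoning
quotient-moves false {w} {q} {i} {j} (step i<k j<i d) isQ qi≡i =
  <⇒≢ᶠ (preserves-< (left-permutesBelow true d) (preserves-< (right-permutesBelow true d) j<i)) (begin
    left true w (right true w j)                       ≡⟨ cong (left true w) (sym (transpose-first i _)) ⟩
    left true w (transpose i (right true w j) i)       ≡⟨ cong (left true w ∘ transpose i _) (sym qi≡i) ⟩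
    left true w (transpose i (right true w j) (q i))   ≡⟨ isQ i ⟩
    left false w i                                     ≡⟨ fixes (left-permutesBelow false d) ≤-refl ⟩
    i                                                  ∎)
  where open ≡-Reasoning

-- Let `q′` be the quotient of the tail for `not s`, and `l = right true w j`. Then `q` is
-- `q′ ∘ transpose i l` for `true` and `transpose i l ∘ q′` for `false`. As `q′` fixes `i`, this
-- inserts `i` into the cycle of `l`, just after or just before `l`, and `cutOut` undoes the
-- insertion.
quotient-tail : ∀ s {w : Word n} {q i j} → Descending k ((i , j) ∷ w) →
  IsQuotient s ((i , j) ∷ w) q → IsQuotient (not s) w (cutOut i q)
quotient-tail true {w} {q} {i} {j} (step i<k j<i d) isQ x with x ≟ i
... | yes refl = trans (fixes (left-permutesBelow false d) ≤-refl) (sym (fixes (left-permutesBelow true d) ≤-refl))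
... | no x≢i with q x ≟ i
...   | yes qx≡i = begin
        left false w (q i)                            ≡⟨ isQ i ⟩
        left true w (transpose i (right true w j) i)  ≡⟨ cong (left true w) (transpose-first i _) ⟩
        left true w (right true w j)                  ≡⟨ cong (left true w) (sym x≡l) ⟩
        left true w x                                 ∎
        where
        open ≡-Reasoning
        x≡l : x ≡ right true w j
        x≡l = transpose≡first⇒second i _ (injective (left-permutesBelow true d) (begin
          left true w (transpose i (right true w j) x)  ≡⟨ sym (isQ x) ⟩
          left false w (q x)                            ≡⟨ cong (left false w) qx≡i ⟩
          left false w i                                ≡⟨ fixes (left-permutesBelow false d) ≤-refl ⟩
          i                                             ≡⟨ sym (fixes (left-permutesBelow true d) ≤-refl) ⟩
          left true w i                                 ∎))
...   | no qx≢i = trans (isQ x) (cong (left true w) (transpose-other x≢i x≢l))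
        where
        open ≡-Reasoning
        x≢l : x ≢ right true w j
        x≢l x≡l = qx≢i (injective (left-permutesBelow false d) (begin
          left false w (q x)                            ≡⟨ isQ x ⟩
          left true w (transpose i (right true w j) x)  ≡⟨ cong (left true w ∘ transpose i _) x≡l ⟩
          left true w (transpose i (right true w j) (right true w j))  ≡⟨ cong (left true w) (transpose-second i (right true w j)) ⟩
          left true w i                                 ≡⟨ fixes (left-permutesBelow true d) ≤-refl ⟩
          i                                             ≡⟨ sym (fixes (left-permutesBelow false d) ≤-refl) ⟩
          left false w i                                ∎))
quotient-tail false {w} {q} {i} {j} (step i<k j<i d) isQ x with x ≟ i
... | yes refl = trans (fixes (left-permutesBelow true d) ≤-refl) (sym (fixes (left-permutesBelow false d) ≤-refl))
... | no x≢i with q x ≟ i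
...   | yes qx≡i = begin
        left true w (q i)                                 ≡⟨ cong (left true w) qi≡l ⟩
        left true w (right true w j)                      ≡⟨ cong (left true w) (sym (transpose-first i _)) ⟩
        left true w (transpose i (right true w j) i)      ≡⟨ cong (left true w ∘ transpose i _) (sym qx≡i) ⟩
        left true w (transpose i (right true w j) (q x))  ≡⟨ isQ x ⟩
        left false w x                                    ∎
        where
        open ≡-Reasoning
        qi≡l : q i ≡ right true w j
        qi≡l = transpose≡first⇒second i _ (injective (left-permutesBelow true d) (begin
          left true w (transpose i (right true w j) (q i))  ≡⟨ isQ i ⟩
          left false w i                                    ≡⟨ fixes (left-permutesBelow false d) ≤-refl ⟩
          i                                                 ≡⟨ sym (fixes (left-permutesBelow true d) ≤-refl) ⟩
          left true w i                                     ∎))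
...   | no qx≢i = trans (cong (left true w) (sym (transpose-other qx≢i qx≢l))) (isQ x)
        where
        open ≡-Reasoning
        qx≢l : q x ≢ right true w j
        qx≢l qx≡l = x≢i (injective (left-permutesBelow false d) (begin
          left false w x                                    ≡⟨ sym (isQ x) ⟩
          left true w (transpose i (right true w j) (q x))  ≡⟨ cong (left true w ∘ transpose i _) qx≡l ⟩
          left true w (transpose i (right true w j) (right true w j))  ≡⟨ cong (left true w) (transpose-second i (right true w j)) ⟩
          left true w i                                     ≡⟨ fixes (left-permutesBelow true d) ≤-refl ⟩
          i                                                 ≡⟨ sym (fixes (left-permutesBelow false d) ≤-refl) ⟩
          left false w i                                    ∎))

-- The value `q i` determines `right true w j`, and `right true w` is injective and depends only on
-- the common tail.
quotient-head : ∀ s {w : Word n} {q i j j′} →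
  Descending k ((i , j) ∷ w) → Descending k ((i , j′) ∷ w) →
  IsQuotient s ((i , j) ∷ w) q → IsQuotient s ((i , j′) ∷ w) q → j ≡ j′
quotient-head true {w} {q} {i} {j} {j′} (step _ _ d) _ isQ isQ′ =
  injective (right-permutesBelow true d) (transpose-inj₂ (injective (left-permutesBelow true d) (trans (sym (isQ i)) (isQ′ i))))
  where
  transpose-inj₂ : ∀ {l l′} → transpose i l i ≡ transpose i l′ i → l ≡ l′
  transpose-inj₂ {l} {l′} eq = trans (sym (transpose-first i l)) (trans eq (transpose-first i l′))
quotient-head false {w} {q} {i} {j} {j′} (step _ _ d) _ isQ isQ′ =
  injective (right-permutesBelow true d) (trans (sym (qi≡l isQ)) (qi≡l isQ′))
  where
  qi≡l : ∀ {j} → IsQuotient false ((i , j) ∷ w) q → q i ≡ right true w j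
  qi≡l isQ = transpose≡first⇒second i _ (injective (left-permutesBelow true d)
    (trans (isQ i) (trans (fixes (left-permutesBelow false d) ≤-refl) (sym (fixes (left-permutesBelow true d) ≤-refl)))))

quotient-determines : ∀ s {w w′ : Word n} {k k′ q} → Descending k w → Descending k′ w′ →
  IsQuotient s w q → IsQuotient s w′ q → w ≡ w′
quotient-determines s [] [] _ _ = refl
quotient-determines s [] d′@(step _ _ _) isQ isQ′ =
  contradiction (quotient-fixes {k = 0} s [] isQ z≤n) (quotient-moves s d′ isQ′)
quotient-determines s d@(step _ _ _) [] isQ isQ′ =
  contradiction (quotient-fixes {k = 0} s [] isQ′ z≤n) (quotient-moves s d isQ)
quotient-determines s {q = q} d@(step {i = i} _ j<i e) d′@(step {i = i′} _ j′<i′ e′) isQ isQ′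
  with <-cmp (toℕ i) (toℕ i′)
-- With `≤-refl` the first word gets the bound `suc (toℕ i)`, so `q` fixes the larger point `i′`,
-- which the second word moves.
... | tri< i<i′ _ _ = contradiction (quotient-fixes s {q = q} (step ≤-refl j<i e) isQ i<i′) (quotient-moves s d′ isQ′)
... | tri> _ _ i′<i = contradiction (quotient-fixes s {q = q} (step ≤-refl j′<i′ e′) isQ′ i′<i) (quotient-moves s d isQ)
... | tri≈ _ i≡i′ _
  with refl ← toℕ-injective i≡i′
  -- The tails are identified first, because reading off `j` requires a common `right true w`.
  with refl ← quotient-determines (not s) e e′ (quotient-tail s d isQ) (quotient-tail s d′ isQ′)
  with refl ← quotient-head s (step ≤-refl j<i e) (step ≤-refl j′<i′ e′) isQ isQ′ = refl

-- Midpoints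

dist-from-quotient : {a b : Perm n} {f : Fin n → Fin n} {r : ℕ} → IsPerm a →
  (∀ x → lookup b x ≡ lookup a (f x)) → cycles f + r ≡ n → dist a b ≡ r
dist-from-quotient {n} {a} {b} {f} {r} a-perm b≗af eq = begin
  n ∸ cycles (inv (lookup a) ∘ lookup b)   ≡⟨ cong (n ∸_) (cycles-cong λ x → trans (cong (inv (lookup a)) (b≗af x)) (inv-left a-perm (f x))) ⟩
  n ∸ cycles f                             ≡⟨ cong (_∸ cycles f) (trans (sym eq) (+-comm (cycles f) r)) ⟩
  r + cycles f ∸ cycles f                  ≡⟨ m+n∸n≡m r (cycles f) ⟩
  r                                        ∎
  where open ≡-Reasoning

isMidpoint-from-lengths : {a m b : Perm n} {r r′ t : ℕ} →
  dist a m ≡ r → dist m b ≡ r′ → dist a b ≡ t →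
  r + r′ ≡ t → r ≡ r′ ⊎ (r ≡ suc r′ ⊎ suc r ≡ r′) → IsMidpoint a m b
isMidpoint-from-lengths refl refl refl sum≡ balanced = sum≡ , balanced

midpoint : Bool → Word n → Perm n → Perm n
midpoint s w a = tabulate (lookup a ∘ left s w)

module _ {a b : Perm n} {w : Word n} (d : Descending n w) (a-perm : IsPerm a)
         (b≗ : ∀ x → lookup b x ≡ lookup a (eval w x)) (s : Bool) where

  private
    m : Perm n
    m = midpoint s w a

    m≗ : ∀ x → lookup m x ≡ lookup a (left s w x)
    m≗ = lookup∘tabulate _

  midpoint-isPerm : IsPerm (midpoint s w a)
  midpoint-isPerm {x} {y} eq =
    injective (left-permutesBelow s d) (a-perm (trans (sym (m≗ x)) (trans eq (m≗ y))))

  midpoint-isMidpoint : IsMidpoint a (midpoint s w a) b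
  midpoint-isMidpoint = isMidpoint-from-lengths {a = a} {m} {b}
    (dist-from-quotient {a = a} {m} a-perm m≗ (cycles-left s d))
    (dist-from-quotient {a = m} {b} midpoint-isPerm
      (λ x → trans (b≗ x) (trans (cong (lookup a) (sym (left-right s d x))) (sym (m≗ _))))
      (cycles-right s d))
    (dist-from-quotient {a = a} {b} a-perm b≗ (cycles-eval d))
    (leftLength-sum s w) (balanced s)
    where
    balanced : ∀ s → let r = leftLength s w ; r′ = leftLength (not s) w in
               r ≡ r′ ⊎ (r ≡ suc r′ ⊎ suc r ≡ r′)
    balanced true with leftLength-balanced w
    ... | inj₁ eq = inj₁ eq
    ... | inj₂ eq = inj₂ (inj₂ eq)
    balanced false with leftLength-balanced w
    ... | inj₁ eq = inj₁ (sym eq)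
    ... | inj₂ eq = inj₂ (inj₁ (sym eq))

lookup-injective : {a b : Perm n} → lookup a ≗ lookup b → a ≡ b
lookup-injective {a = a} {b} eq =
  trans (sym (tabulate∘lookup a)) (trans (tabulate-cong eq) (tabulate∘lookup b))

-- The word is a field, so injectivity concerns every descending word with the required `ratio`,
-- however it was found.
record MidpointPair (ab mm′ : Perm n × Perm n) : Set where
  constructor midpointPair
  field
    word       : Word n
    descending : Descending n word
    isPerm     : IsPerm (proj₁ ab)
    ratio      : ∀ x → lookup (proj₂ ab) x ≡ lookup (proj₁ ab) (eval word x)
    first      : proj₁ mm′ ≡ midpoint true word (proj₁ ab)
    second     : proj₂ mm′ ≡ midpoint false word (proj₁ ab)

midpointPair-injective : {ab cd mm′ : Perm n × Perm n} →
  MidpointPair ab mm′ → MidpointPair cd mm′ → ab ≡ cd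
midpointPair-injective {n} {a , b} {c , d}
  (midpointPair w desc a-perm b≗ refl refl) (midpointPair w′ desc′ c-perm d≗ eq eq′)
  = conclude (quotient-determines true desc desc′ isQ isQ′)
  where
  open ≡-Reasoning

  unfold : ∀ {s} → midpoint s w a ≡ midpoint s w′ c →
           ∀ x → lookup a (left s w x) ≡ lookup c (left s w′ x)
  unfold {s} e x = begin
    lookup a (left s w x)         ≡⟨ sym (lookup∘tabulate _ x) ⟩
    lookup (midpoint s w a) x     ≡⟨ cong (λ m → lookup m x) e ⟩
    lookup (midpoint s w′ c) x    ≡⟨ lookup∘tabulate _ x ⟩
    lookup c (left s w′ x)        ∎

  -- The quotient of the two midpoints, from which `a` cancels; equality of the midpoints makes it a
  -- quotient for `w′` as well.
  q : Fin n → Fin n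
  q x = inv (left true w) (left false w x)

  isQ : IsQuotient true w q
  isQ x = inv-right (injective (left-permutesBelow true desc)) _

  isQ′ : IsQuotient true w′ q
  isQ′ x = c-perm (begin
    lookup c (left true w′ (q x))  ≡⟨ sym (unfold {true} eq (q x)) ⟩
    lookup a (left true w (q x))   ≡⟨ cong (lookup a) (isQ x) ⟩
    lookup a (left false w x)      ≡⟨ unfold {false} eq′ x ⟩
    lookup c (left false w′ x)     ∎)

  conclude : w ≡ w′ → (a , b) ≡ (c , d)
  conclude refl = cong₂ _,_ (lookup-injective a≗c) (lookup-injective λ x →
    trans (b≗ x) (trans (a≗c _) (sym (d≗ x))))
    where
    a≗c : lookup a ≗ lookup c
    -- Both `a` and `c` give the same first midpoint after composition with the same surjective
    -- `left true w`, so they agree everywhere.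
    a≗c y with x , refl ← injective⇒surjective (injective (left-permutesBelow true desc)) y =
      unfold {true} eq x

midpointPair-exists : {a b : Perm n} → IsPerm a → IsPerm b →
  ∃[ m ] ∃[ m′ ] MidpointPair (a , b) (m , m′) ×
    (IsPerm m × IsMidpoint a m b) × (IsPerm m′ × IsMidpoint a m′ b)
midpointPair-exists {n} {a} {b} a-perm b-perm
  with w , d , ev ← factorise n ≤-refl {p = λ x → inv (lookup a) (lookup b x)} (record
         { injective = λ {x} {y} eq → b-perm (trans (sym (inv-right a-perm _)) (trans (cong (lookup a) eq) (inv-right a-perm _)))
         -- Vacuous, since every point is below `n`.
         ; fixes = λ {x} n≤x → contradiction n≤x (<⇒≱ (toℕ<n x))
         }) =
  let b≗ = λ x → sym (trans (cong (lookup a) (ev x)) (inv-right a-perm (lookup b x))) in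
  midpoint true w a , midpoint false w a , midpointPair w d a-perm b≗ refl refl ,
  (midpoint-isPerm {a = a} {b} d a-perm b≗ true , midpoint-isMidpoint {a = a} {b} d a-perm b≗ true) ,
  (midpoint-isPerm {a = a} {b} d a-perm b≗ false , midpoint-isMidpoint {a = a} {b} d a-perm b≗ false)

theorem4p1 : (n : ℕ) (A B : List (Perm n)) →
    All IsPerm A → Unique A → A ≢ [] →
    All IsPerm B → Unique B → B ≢ [] →
    (M : List (Perm n)) → Unique M →
    (∀ m → (m ∈ M) ⇔ InMidpointSet A B m) →
    length A * length B ≤ length M * length M
theorem4p1 n A B A-perm A-uniq _ B-perm B-uniq _ M _ M-midpoints =
  -- The logarithmic inequality, doubled and exponentiated, compares the sizes of `A × B` and
  -- `M × M`.
  subst₂ _≤_ (length-cartesianProduct A B) (length-cartesianProduct M M)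
    (length-≤-of-injective-relation MidpointPair midpointPair-injective
      (cartesianProduct M M) (cartesianProduct⁺ A-uniq B-uniq) image)
  where
  image : ∀ {ab} → ab ∈ cartesianProduct A B →
          ∃ λ mm′ → mm′ ∈ cartesianProduct M M × MidpointPair ab mm′
  image {a , b} ab∈ with a∈A , b∈B ← ∈-cartesianProduct⁻ A B ab∈
    with m , m′ , pair , (m-perm , m-mid) , (m′-perm , m′-mid)
         ← midpointPair-exists {a = a} {b} (All.lookup A-perm a∈A) (All.lookup B-perm b∈B) =
    (m , m′) ,
    ∈-cartesianProduct⁺
      (Equivalence.from (M-midpoints m) (m-perm , a , b , a∈A , b∈B , m-mid))
      (Equivalence.from (M-midpoints m′) (m′-perm , a , b , a∈A , b∈B , m′-mid)) ,
    pair
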